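{- For every integer $n \geq 11$ and every integer $k$ with $5\le k\le n+1$, there exists a separating union-closed family $\mathcal{A}^{(k)}$ with base set $[n]$, height $h=k$ and $|\mathcal{B}(\mathcal{A}^{(k)})|=1$ such that \[\mathrm{Avg}(\mathcal{A}^{(k)}) = \frac{\sum_{A \in \mathcal{A}^{(k)}}|A|}{|\mathcal{A}^{(k)}|} < \frac{n}{2}.\]
   Context: A family of sets $\mathcal{A}$ is union-closed if it is a finite family of distinct finite sets with at least one nonempty member set, and $X,Y\in\mathcal{A}$ implies $X\cup Y\in\mathcal{A}$ (the empty set may be a member). For a family $\mathcal{F}$, $b(\mathcal{F})=\bigcup_{F\in\mathcal{F}}F$; the base set $b(\mathcal{A})$ is denoted $[n]=\{1,\dots,n\}$. $\mathcal{A}$ is separating if for any two distinct $x,y\in[n]$ there is $A\in\mathcal{A}$ containing exactly one of $x,y$. A chain in $\mathcal{A}$ is a subfamily any two distinct members of which are comparable under proper inclusion; the height $h$ of $\mathcal{A}$ is the maximum size of a chain in $\mathcal{A}$. For real $x\ge 0$, $\mathcal{A}_{<x}=\{A\in\mathcal{A} : |A|<x\}$. For $\mathcal{S}\subseteq\mathcal{A}$ and $S\in\mathcal{S}$, $\mathrm{irr}_{\mathcal{S}}(S)=\{s\in S : s\notin b(\mathcal{S}\setminus\{S\})\}$, and $\mathcal{S}$ is irredundant if $\mathrm{irr}_{\mathcal{S}}(S)\neq\emptyset$ for every $S\in\mathcal{S}$. Set $B=b(\mathcal{A}_{<n/2})$, and let $\mathcal{B}(\mathcal{A})$ denote any irredundant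 subfamily of $\mathcal{A}_{<n/2}$ of minimum size such that $b(\mathcal{B}(\mathcal{A}))=B$. -}

module Defs where

open import Data.Bool.Properties using () renaming (_≟_ to _≟ᵇ_)
open import Data.Fin.Base using (Fin)
open import Data.Fin.Subset using (Subset; _∈_; _∉_; _⊂_; _∪_; _─_; ⋃; ∣_∣; Nonempty)
open import Data.Integer.Base using (+_)
open import Data.List.Base using (List; []; _∷_; length; map; filter)
open import Data.List.Membership.Propositional using () renaming (_∈_ to _∈ᶠ_)
open import Data.List.Relation.Binary.Subset.Propositional using () renaming (_⊆_ to _⊆ᶠ_)
open import Data.List.Relation.Unary.Unique.Propositional using (Unique)
open import Data.Nat.Base using (ℕ; NonZero; _≤_)
open import Data.Nat.ListAction using (sum)
open import Data.Product.Base using (_×_; _,_; ∃-syntax)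
open import Data.Rational.Base using (ℚ; _/_)
open import Data.Rational.Properties using (_<?_)
open import Data.Sum.Base using (_⊎_)
open import Data.Vec.Properties using (≡-dec)
open import Relation.Binary.Definitions using (DecidableEquality)
open import Relation.Binary.PropositionalEquality using (_≡_; _≢_)
open import Relation.Nullary.Decidable using (¬?)

-- The ground set [n] is Fin n.  A finite family is listed by its members;
-- that the members are distinct (so that length is cardinality) is required
-- separately, by Unique, in UnionClosed and Subfamily.
Family : ℕ → Set
Family n = List (Subset n)

_≟ˢ_ : ∀ {n} → DecidableEquality (Subset n)
_≟ˢ_ = ≡-dec _≟ᵇ_

b : ∀ {n} → Family n → Subset n
b = ⋃

record UnionClosed {n : ℕ} (𝓐 : Family n) : Set where
  field
    distinct : Unique 𝓐
    nonempty : ∃[ X ] (X ∈ᶠ 𝓐 × Nonempty X)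
    closed   : ∀ {X Y} → X ∈ᶠ 𝓐 → Y ∈ᶠ 𝓐 → (X ∪ Y) ∈ᶠ 𝓐

Separating : ∀ {n} → Family n → Set
Separating {n} 𝓐 = ∀ (x y : Fin n) → x ≢ y →
  ∃[ A ] (A ∈ᶠ 𝓐 × ((x ∈ A × y ∉ A) ⊎ (x ∉ A × y ∈ A)))

record Subfamily {n : ℕ} (𝓢 𝓐 : Family n) : Set where
  field
    distinct : Unique 𝓢
    included : 𝓢 ⊆ᶠ 𝓐

record Chain {n : ℕ} (𝓒 𝓐 : Family n) : Set where
  field
    subfamily  : Subfamily 𝓒 𝓐
    comparable : ∀ {X Y} → X ∈ᶠ 𝓒 → Y ∈ᶠ 𝓒 → X ≢ Y → X ⊂ Y ⊎ Y ⊂ X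

record HasHeight {n : ℕ} (𝓐 : Family n) (h : ℕ) : Set where
  field
    attained : ∃[ 𝓒 ] (Chain 𝓒 𝓐 × length 𝓒 ≡ h)
    maximal  : ∀ {𝓒} → Chain 𝓒 𝓐 → length 𝓒 ≤ h

-- The threshold is rational; it is only ever used at n/2.
below : ∀ {n} → ℚ → Family n → Family n
below x = filter (λ A → (+ ∣ A ∣ / 1) <? x)

half : ℕ → ℚ
half n = + n / 2

_∖[_] : ∀ {n} → Family n → Subset n → Family n
𝓢 ∖[ S ] = filter (λ T → ¬? (T ≟ˢ S)) 𝓢

irr : ∀ {n} → Family n → Subset n → Subset n
irr 𝓢 S = S ─ b (𝓢 ∖[ S ])

Irredundant : ∀ {n} → Family n → Set
Irredundant 𝓢 = ∀ {S} → S ∈ᶠ 𝓢 → Nonempty (irr 𝓢 S)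

record IrredundantCover {n : ℕ} (𝓐 𝓢 : Family n) : Set where
  field
    subfamily   : Subfamily 𝓢 (below (half n) 𝓐)
    irredundant : Irredundant 𝓢
    covers      : b 𝓢 ≡ b (below (half n) 𝓐)

-- Is𝓑 𝓐 𝓢 : 𝓢 is an admissible choice of 𝓑(𝓐).
record Is𝓑 {n : ℕ} (𝓐 𝓢 : Family n) : Set where
  field
    cover   : IrredundantCover 𝓐 𝓢
    minimum : ∀ {𝓣} → IrredundantCover 𝓐 𝓣 → length 𝓢 ≤ length 𝓣

-- |𝓑(𝓐)| = m.  As 𝓑(𝓐) denotes any admissible choice, a choice is required
-- to exist and every choice to have size m.
∣𝓑_∣≡_ : ∀ {n} → Family n → ℕ → Set
∣𝓑 𝓐 ∣≡ m = (∃[ 𝓢 ] Is𝓑 𝓐 𝓢) × (∀ {𝓢} → Is𝓑 𝓐 𝓢 → length 𝓢 ≡ m)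

avg : ∀ {n} (𝓐 : Family n) .{{_ : NonZero (length 𝓐)}} → ℚ
avg 𝓐 = + sum (map ∣_∣ 𝓐) / length 𝓐

unionClosed⇒nonZero : ∀ {n} {𝓐 : Family n} → UnionClosed 𝓐 → NonZero (length 𝓐)
unionClosed⇒nonZero {𝓐 = _ ∷ _} _ = _
unionClosed⇒nonZero {𝓐 = []} uc with UnionClosed.nonempty uc
... | _ , () , _

Avg : ∀ {n} (𝓐 : Family n) → UnionClosed 𝓐 → ℚ
Avg 𝓐 uc = avg 𝓐 {{unionClosed⇒nonZero uc}}

{-# OPTIONS --safe #-}
-- Write n = q + m with q = m + 1 or m + 2, and split [n] = N ⊎ M with |M| = m.
-- The small members are the subsets of M missing at most j ≥ 2 points of M.
-- The large members are T ∪ M, where N ∖ T runs through ∅, {1}, …, {1..r}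
-- and the sets {1..r, y} with y > r + 1.  As 2m < n ≤ 2(m+1), M is the
-- largest member below n/2.  The heights add up to (j + 1) + (r + 2), which
-- takes every value from 5 to n + 1.  There are only q large members, whereas
-- already for j = 2 the small ones are quadratically many and miss at least
-- q + 2 points each, with m + 1 exceptions; this forces the average below n/2.
module Submission where

open import Defs
open import Data.Bool.Base using (true; false)
open import Data.Empty using () renaming (⊥ to ⊥₀)
open import Data.Fin.Base using (Fin; zero; suc; _↑ˡ_; _↑ʳ_; splitAt; join)
open import Data.Fin.Properties using (injective⇒≤; join-splitAt)
open import Data.Fin.Subset using (Subset; inside; outside; _∈_; _⊆_; _⊂_; _⊃_; _∪_; _─_; ∁; ⁅_⁆; ∣_∣; ⊤; ⊥; Nonempty)
open import Data.Fin.Subset.Properties using (∣p∣≤n; ∣⊤∣≡n; ∣⊥∣≡0; ∣⁅x⁆∣≡1; ∣∁p∣≡n∸∣p∣; p⊂q⇒∣p∣<∣q∣; p⊂q⇒p⊆q; s⊂s; s⊆s; out⊆; out⊂in; drop-∷-⊆; ⊥⊆; ⊆⊤; ⊆-antisym; p⊆p∪q; q⊆p∪q; ∣p∣≤∣p∪q∣; x∈p∪q⁻; ∪-identityʳ; ∉⊥; p─⊥≡p; ∪-zeroˡ; ∪-zeroʳ; ∪-identityˡ)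
open import Data.Integer.Base using (+_)
import Data.Integer.Base as ℤ
import Data.Integer.Properties as ℤ
open import Data.List.Base using (List; []; _∷_; [_]; _++_; length; map; lookup)
open import Data.List.Membership.Propositional using () renaming (_∈_ to _∈ᶠ_)
open import Data.List.Membership.Propositional.Properties using (∈-map⁺; ∈-map⁻; ∈-++⁺ˡ; ∈-++⁺ʳ; ∈-++⁻; ∈-filter⁺; ∈-filter⁻; ∈-lookup)
open import Data.List.Properties using (length-map; length-++; map-++; map-∘)
open import Data.List.Relation.Unary.All using ([]; _∷_)
import Data.List.Relation.Unary.All as All
import Data.List.Relation.Unary.All.Properties as All
open import Data.List.Relation.Unary.AllPairs using (AllPairs; []; _∷_)
import Data.List.Relation.Unary.AllPairs as AllPairs
import Data.List.Relation.Unary.AllPairs.Properties as AllPairs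
open import Data.List.Relation.Unary.Any using (here; there; index)
open import Data.List.Relation.Unary.Any.Properties using (lookup-index)
open import Data.List.Relation.Unary.Unique.Propositional using (Unique)
import Data.List.Relation.Unary.Unique.Propositional.Properties as Unique
open import Data.List.Relation.Binary.Subset.Propositional using () renaming (_⊆_ to _⊆ᶠ_)
import Data.List.Relation.Binary.Subset.Propositional.Properties as ⊆ᶠ
open import Data.Nat.Base using (ℕ; zero; suc; _+_; _*_; _≤_; NonZero; z≤n; s≤s)
import Data.Nat.Base as ℕ
open import Data.Nat.ListAction using (sum)
open import Data.Nat.ListAction.Properties using (sum-++)
open import Data.Nat.Properties
open import Data.Nat.Tactic.RingSolver using (solve-∀)
open import Data.Product.Base using (Σ-syntax; ∃-syntax; _×_; _,_)
open import Data.Rational.Base using (_<_; _/_)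
import Data.Rational.Properties as ℚ
import Data.Rational.Unnormalised.Base as ℚᵘ
import Data.Rational.Unnormalised.Properties as ℚᵘ
open import Data.Sum.Base using (_⊎_; inj₁; inj₂)
import Data.Vec.Base as Vec
open import Data.Vec.Base using ([]; _∷_; here; there)
open import Data.Vec.Properties using (∷-injectiveʳ; ++-injectiveˡ; ++-injectiveʳ; lookup-++ˡ; lookup-++ʳ; lookup-replicate; zipWith-++; []=⇒lookup; lookup⇒[]=)
open import Function.Base using (_∘_)
open import Relation.Binary.PropositionalEquality using (_≡_; _≢_; refl; sym; trans; cong; cong₂; subst; subst₂)
open import Relation.Nullary using (contradiction; yes; no)

-- Comparisons with n/2 in integer form

2*s<n*l⇒s/l<n/2 : ∀ s l n .{{_ : NonZero l}} → 2 * s ℕ.< n * l → + s / l < half n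
2*s<n*l⇒s/l<n/2 s (suc l) n lt = ℚ.toℚᵘ-cancel-<
  (ℚᵘ.<-respˡ-≃ (ℚᵘ.≃-sym (ℚ.toℚᵘ-fromℚᵘ (ℚᵘ.mkℚᵘ (+ s) l)))
    (ℚᵘ.<-respʳ-≃ (ℚᵘ.≃-sym (ℚ.toℚᵘ-fromℚᵘ (ℚᵘ.mkℚᵘ (+ n) 1)))
      (ℚᵘ.*<* (subst₂ ℤ._<_ (ℤ.pos-* s 2) (ℤ.pos-* n (suc l))
        (ℤ.+<+ (subst (ℕ._< n * suc l) (*-comm 2 s) lt))))))

s/1<n/2⇒2*s<n : ∀ s n → + s / 1 < half n → 2 * s ℕ.< n
s/1<n/2⇒2*s<n s n lt
  with ℚᵘ.<-respˡ-≃ (ℚ.toℚᵘ-fromℚᵘ (ℚᵘ.mkℚᵘ (+ s) 0))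
         (ℚᵘ.<-respʳ-≃ (ℚ.toℚᵘ-fromℚᵘ (ℚᵘ.mkℚᵘ (+ n) 1)) (ℚ.toℚᵘ-mono-< lt))
... | ℚᵘ.*<* p = subst₂ ℕ._<_ (*-comm s 2) (*-identityʳ n)
                   (ℤ.drop‿+<+ (subst₂ ℤ._<_ (sym (ℤ.pos-* s 2)) (sym (ℤ.pos-* n 1)) p))

-- Unions and minimum irredundant covers

⊆⋃ : ∀ {n} {𝓐 : Family n} {A} → A ∈ᶠ 𝓐 → A ⊆ b 𝓐
⊆⋃ {𝓐 = A ∷ 𝓐} (here refl) x∈A = p⊆p∪q (b 𝓐) x∈A
⊆⋃ {𝓐 = B ∷ 𝓐} (there A∈𝓐) x∈A = q⊆p∪q B (b 𝓐) (⊆⋃ A∈𝓐 x∈A)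

⋃⊆ : ∀ {n} {𝓐 : Family n} {B} → (∀ {A} → A ∈ᶠ 𝓐 → A ⊆ B) → b 𝓐 ⊆ B
⋃⊆ {𝓐 = []}    h x∈⊥ = contradiction x∈⊥ ∉⊥
⋃⊆ {𝓐 = A ∷ 𝓐} h x∈∪ with x∈p∪q⁻ A (b 𝓐) x∈∪
... | inj₁ x∈A = h (here refl) x∈A
... | inj₂ x∈⋃ = ⋃⊆ (h ∘ there) x∈⋃

⊤∈⇒⋃≡⊤ : ∀ {n} {𝓐 : Family n} → ⊤ ∈ᶠ 𝓐 → b 𝓐 ≡ ⊤
⊤∈⇒⋃≡⊤ ⊤∈𝓐 = ⊆-antisym ⊆⊤ (⊆⋃ ⊤∈𝓐)

-- A member `M` below n/2 that contains all others below n/2 equals their union, so `[ M ]` is an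
-- irredundant cover. Since `M` is nonempty, the empty family covers too little, and the minimum is
-- exactly one.
∣𝓑∣≡1 : ∀ {n} {𝓐 : Family n} {M} → M ∈ᶠ 𝓐 → Nonempty M → 2 * ∣ M ∣ ℕ.< n →
        (∀ {A} → A ∈ᶠ 𝓐 → 2 * ∣ A ∣ ℕ.< n → A ⊆ M) → ∣𝓑 𝓐 ∣≡ 1
∣𝓑∣≡1 {n} {𝓐} {M} M∈𝓐 (x , x∈M) M<n/2 below⊆M =
  ([ M ] , record { cover = coverM ; minimum = 1≤cover })
  , λ is𝓑 → ≤-antisym (Is𝓑.minimum is𝓑 coverM) (1≤cover (Is𝓑.cover is𝓑))
  where
  small = λ (A : Subset n) → (+ ∣ A ∣ / 1) ℚ.<? half n

  M∈below : M ∈ᶠ below (half n) 𝓐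
  M∈below = ∈-filter⁺ small M∈𝓐
    (2*s<n*l⇒s/l<n/2 ∣ M ∣ 1 n (subst (2 * ∣ M ∣ ℕ.<_) (sym (*-identityʳ n)) M<n/2))

  ⋃below≡M : b (below (half n) 𝓐) ≡ M
  ⋃below≡M = ⊆-antisym
    (⋃⊆ λ {A} A∈ → let A∈𝓐 , A<n/2 = ∈-filter⁻ small A∈ in
                   below⊆M A∈𝓐 (s/1<n/2⇒2*s<n ∣ A ∣ n A<n/2))
    (⊆⋃ M∈below)

  [M]∖M≡[] : [ M ] ∖[ M ] ≡ []
  [M]∖M≡[] with M ≟ˢ M
  ... | yes _  = refl
  ... | no M≢M = contradiction refl M≢M

  coverM : IrredundantCover 𝓐 [ M ]
  coverM = record
    { subfamily   = record { distinct = [] ∷ [] ; included = λ { (here refl) → M∈below } }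
    ; irredundant = λ { (here refl) → x , subst (λ 𝓢 → x ∈ M ─ b 𝓢) (sym [M]∖M≡[])
                                            (subst (x ∈_) (sym (p─⊥≡p M)) x∈M) }
    ; covers      = trans (∪-identityʳ M) (sym ⋃below≡M)
    }

  1≤cover : ∀ {𝓢} → IrredundantCover 𝓐 𝓢 → 1 ≤ length 𝓢
  1≤cover {_ ∷ _} _ = s≤s z≤n
  1≤cover {[]}    c = contradiction
    (subst (x ∈_) (sym (trans (IrredundantCover.covers c) ⋃below≡M)) x∈M) ∉⊥

-- Height from a chain realising all cardinalities

-- A chain meets each cardinality at most once, so a chain realising every
-- cardinality that occurs in the family is a longest one.
record Spine {n} (𝓒 𝓐 : Family n) : Set where
  field
    descending : AllPairs _⊃_ 𝓒
    included   : 𝓒 ⊆ᶠ 𝓐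
    sizes      : ∀ {A} → A ∈ᶠ 𝓐 → ∣ A ∣ ∈ᶠ map ∣_∣ 𝓒

lookup-injective : ∀ {a} {A : Set a} {xs : List A} → Unique xs →
                   ∀ {i j} → lookup xs i ≡ lookup xs j → i ≡ j
lookup-injective (_ ∷ _)  {zero}  {zero}  _  = refl
lookup-injective (p ∷ _)  {zero}  {suc j} eq = contradiction eq (All.lookup p (∈-lookup j))
lookup-injective (p ∷ _)  {suc i} {zero}  eq = contradiction (sym eq) (All.lookup p (∈-lookup i))
lookup-injective (_ ∷ ps) {suc i} {suc j} eq = cong suc (lookup-injective ps eq)

-- Sending each member of `𝓓` to the position of its cardinality in the list of sizes of `𝓒` is
-- injective, since comparable distinct sets differ in cardinality.
spine-longest : ∀ {n} {𝓒 𝓐 𝓓 : Family n} → Spine 𝓒 𝓐 → Chain 𝓓 𝓐 → length 𝓓 ≤ length 𝓒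
spine-longest {𝓒 = 𝓒} {𝓐} {𝓓} spine chain =
  subst (length 𝓓 ≤_) (length-map ∣_∣ 𝓒) (injective⇒≤ (lookup-injective distinct ∘ size-injective _ _ ∘ index-injective _ _))
  where
  open Chain chain
  open Subfamily subfamily

  size∈ : ∀ i → ∣ lookup 𝓓 i ∣ ∈ᶠ map ∣_∣ 𝓒
  size∈ i = Spine.sizes spine (included (∈-lookup i))

  index-injective : ∀ i j → index (size∈ i) ≡ index (size∈ j) → ∣ lookup 𝓓 i ∣ ≡ ∣ lookup 𝓓 j ∣
  index-injective i j eq = trans (lookup-index (size∈ i))
    (trans (cong (lookup (map ∣_∣ 𝓒)) eq) (sym (lookup-index (size∈ j))))

  size-injective : ∀ i j → ∣ lookup 𝓓 i ∣ ≡ ∣ lookup 𝓓 j ∣ → lookup 𝓓 i ≡ lookup 𝓓 j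
  size-injective i j eq with lookup 𝓓 i ≟ˢ lookup 𝓓 j
  ... | yes X≡Y = X≡Y
  ... | no X≢Y with comparable (∈-lookup i) (∈-lookup j) X≢Y
  ...   | inj₁ X⊂Y = contradiction eq (<⇒≢ (p⊂q⇒∣p∣<∣q∣ X⊂Y))
  ...   | inj₂ Y⊂X = contradiction (sym eq) (<⇒≢ (p⊂q⇒∣p∣<∣q∣ Y⊂X))

descending-comparable : ∀ {n} {𝓒 : Family n} → AllPairs _⊃_ 𝓒 →
                        ∀ {X Y} → X ∈ᶠ 𝓒 → Y ∈ᶠ 𝓒 → X ≢ Y → X ⊂ Y ⊎ Y ⊂ X
descending-comparable (_ ∷ _)  (here refl) (here refl) X≢Y = contradiction refl X≢Y
descending-comparable (p ∷ _)  (here refl) (there Y∈)  _   = inj₂ (All.lookup p Y∈)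
descending-comparable (p ∷ _)  (there X∈)  (here refl) _   = inj₁ (All.lookup p X∈)
descending-comparable (_ ∷ ps) (there X∈)  (there Y∈)  X≢Y = descending-comparable ps X∈ Y∈ X≢Y

spine⇒height : ∀ {n} {𝓒 𝓐 : Family n} → Spine 𝓒 𝓐 → HasHeight 𝓐 (length 𝓒)
spine⇒height {𝓒 = 𝓒} spine = record
  { attained = 𝓒 , record
      { subfamily  = record
          { distinct = AllPairs.map (λ { X⊃Y refl → <-irrefl refl (p⊂q⇒∣p∣<∣q∣ X⊃Y) }) descending
          ; included = included }
      ; comparable = descending-comparable descending } , refl
  ; maximal  = spine-longest spine }
  where open Spine spine

-- Counting missing points

missing : ∀ {n} → Family n → ℕ
missing = sum ∘ map (∣_∣ ∘ ∁)

∣p∣+∣∁p∣≡n : ∀ {n} (p : Subset n) → ∣ p ∣ + ∣ ∁ p ∣ ≡ n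
∣p∣+∣∁p∣≡n p = trans (cong (λ s → ∣ p ∣ + s) (∣∁p∣≡n∸∣p∣ p)) (m+[n∸m]≡n (∣p∣≤n p))

sizes+missing : ∀ {n} (𝓐 : Family n) → sum (map ∣_∣ 𝓐) + missing 𝓐 ≡ n * length 𝓐
sizes+missing {n} []      = sym (*-zeroʳ n)
sizes+missing {n} (A ∷ 𝓐) =
  trans (swap (∣ A ∣) _ (∣ ∁ A ∣) _) (trans (cong₂ _+_ (∣p∣+∣∁p∣≡n A) (sizes+missing 𝓐)) (sym (*-suc n _)))
  where
  swap : ∀ a b c d → (a + b) + (c + d) ≡ (a + c) + (b + d)
  swap = solve-∀

-- Sizes and missing points together total n times the number of members, so the average is below
-- n/2 once the missing points exceed half of that total.
Avg<half : ∀ {n} {𝓐 : Family n} (uc : UnionClosed 𝓐) → n * length 𝓐 ℕ.< 2 * missing 𝓐 → Avg 𝓐 uc < half n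
Avg<half {n} {𝓐} uc lt = 2*s<n*l⇒s/l<n/2 s (length 𝓐) n {{unionClosed⇒nonZero uc}}
  (+-cancelʳ-< (n * length 𝓐) (2 * s) (n * length 𝓐) (begin-strict
    2 * s + n * length 𝓐                <⟨ +-monoʳ-< (2 * s) lt ⟩
    2 * s + 2 * missing 𝓐               ≡⟨ *-distribˡ-+ 2 s (missing 𝓐) ⟨
    2 * (s + missing 𝓐)                 ≡⟨ cong (2 *_) (sizes+missing 𝓐) ⟩
    2 * (n * length 𝓐)                  ≡⟨ cong (λ t → n * length 𝓐 + t) (+-identityʳ _) ⟩
    n * length 𝓐 + n * length 𝓐         ∎))
  where
  open ≤-Reasoning
  s = sum (map ∣_∣ 𝓐)

missing-++ : ∀ {n} (𝓐 𝓑 : Family n) → missing (𝓐 ++ 𝓑) ≡ missing 𝓐 + missing 𝓑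
missing-++ 𝓐 𝓑 = trans (cong sum (map-++ _ 𝓐 𝓑)) (sum-++ (map _ 𝓐) (map _ 𝓑))

-- The constant `c` is what `f` adds to each complement: 0 or 1 for a new coordinate, 0 for an
-- appended `⊤`, `q` for a prepended `⊥` of length `q`.
missing-map : ∀ {m n} (f : Subset m → Subset n) c → (∀ A → ∣ ∁ (f A) ∣ ≡ c + ∣ ∁ A ∣) →
              ∀ 𝓐 → missing (map f 𝓐) ≡ c * length 𝓐 + missing 𝓐
missing-map f c h []      = sym (trans (+-identityʳ (c * 0)) (*-zeroʳ c))
missing-map f c h (A ∷ 𝓐) = trans (cong₂ _+_ (h A) (missing-map f c h 𝓐)) (regroup c _ _ _)
  where
  regroup : ∀ c a l t → (c + a) + (c * l + t) ≡ c * suc l + (a + t)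
  regroup = solve-∀

missing-inside : ∀ {n} (𝓐 : Family n) → missing (map (inside ∷_) 𝓐) ≡ missing 𝓐
missing-inside = missing-map (inside ∷_) 0 (λ _ → refl)

missing-outside : ∀ {n} (𝓐 : Family n) → missing (map (outside ∷_) 𝓐) ≡ length 𝓐 + missing 𝓐
missing-outside 𝓐 = trans (missing-map (outside ∷_) 1 (λ _ → refl) 𝓐)
                          (cong (_+ missing 𝓐) (*-identityˡ (length 𝓐)))

-- Separation by Boolean lookups

-- Phrased by lookups so that it computes on coordinates and symmetry is a single `sym`.
Splits : ∀ {n} → Family n → Fin n → Fin n → Set
Splits 𝓐 x y = ∃[ A ] (A ∈ᶠ 𝓐 × Vec.lookup A x ≢ Vec.lookup A y)

Splits-sym : ∀ {n} {𝓐 : Family n} {x y} → Splits 𝓐 x y → Splits 𝓐 y x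
Splits-sym (A , A∈ , ne) = A , A∈ , ne ∘ sym

splits⇒separating : ∀ {n} {𝓐 : Family n} → (∀ x y → x ≢ y → Splits 𝓐 x y) → Separating 𝓐
splits⇒separating splits x y x≢y with splits x y x≢y
... | A , A∈ , ne with Vec.lookup A x in eqx | Vec.lookup A y in eqy
...   | true  | true  = contradiction refl ne
...   | false | false = contradiction refl ne
...   | true  | false = A , A∈ , inj₁ (lookup⇒[]= x A eqx , λ y∈A → contradiction (trans (sym eqy) ([]=⇒lookup y∈A)) λ ())
...   | false | true  = A , A∈ , inj₂ ((λ x∈A → contradiction (trans (sym eqx) ([]=⇒lookup x∈A)) λ ()) , lookup⇒[]= y A eqy)

-- Small members: nearly full sets

-- The subsets missing at most j points.
nearFull : ∀ m → ℕ → Family m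
nearFull zero    j       = [ [] ]
nearFull (suc m) zero    = map (inside ∷_) (nearFull m zero)
nearFull (suc m) (suc j) = map (inside ∷_) (nearFull m (suc j)) ++ map (outside ∷_) (nearFull m j)

-- With `∈-nearFull⁻` this makes membership a condition on cardinality alone, which yields closure
-- under union and the membership of `∁ ⁅ x ⁆`. The additive form avoids truncated subtraction.
∈-nearFull⁺ : ∀ {m} j {A : Subset m} → m ≤ ∣ A ∣ + j → A ∈ᶠ nearFull m j
∈-nearFull⁺ {zero}  j       {[]}          _ = here refl
∈-nearFull⁺ {suc m} zero    {outside ∷ A} h = contradiction h (<⇒≱ (s≤s (subst (_≤ m) (sym (+-identityʳ _)) (∣p∣≤n A))))
∈-nearFull⁺ {suc m} zero    {inside  ∷ A} h = ∈-map⁺ _ (∈-nearFull⁺ zero (ℕ.s≤s⁻¹ h))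
∈-nearFull⁺ {suc m} (suc j) {inside  ∷ A} h = ∈-++⁺ˡ (∈-map⁺ _ (∈-nearFull⁺ (suc j) (ℕ.s≤s⁻¹ h)))
∈-nearFull⁺ {suc m} (suc j) {outside ∷ A} h = ∈-++⁺ʳ _ (∈-map⁺ _ (∈-nearFull⁺ j (ℕ.s≤s⁻¹ (subst (suc m ≤_) (+-suc ∣ A ∣ j) h))))

∈-nearFull⁻ : ∀ {m} j {A : Subset m} → A ∈ᶠ nearFull m j → m ≤ ∣ A ∣ + j
∈-nearFull⁻ {zero}  j    _ = z≤n
∈-nearFull⁻ {suc m} zero A∈ with ∈-map⁻ _ A∈
... | _ , B∈ , refl = s≤s (∈-nearFull⁻ zero B∈)
∈-nearFull⁻ {suc m} (suc j) A∈ with ∈-++⁻ (map (inside ∷_) (nearFull m (suc j))) A∈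
... | inj₁ A∈ˡ with ∈-map⁻ _ A∈ˡ
...   | _ , B∈ , refl = s≤s (∈-nearFull⁻ (suc j) B∈)
∈-nearFull⁻ {suc m} (suc j) A∈ | inj₂ A∈ʳ with ∈-map⁻ _ A∈ʳ
...   | B , B∈ , refl = subst (suc m ≤_) (sym (+-suc ∣ B ∣ j)) (s≤s (∈-nearFull⁻ j B∈))

⊤∈nearFull : ∀ m j → ⊤ ∈ᶠ nearFull m j
⊤∈nearFull m j = ∈-nearFull⁺ j (subst (λ s → m ≤ s + j) (sym (∣⊤∣≡n m)) (m≤m+n m j))

∁⁅x⁆∈nearFull : ∀ {m} (x : Fin m) j → ∁ ⁅ x ⁆ ∈ᶠ nearFull m (suc j)
∁⁅x⁆∈nearFull {m} x j = ∈-nearFull⁺ (suc j) (begin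
  m                           ≡⟨ ∣p∣+∣∁p∣≡n ⁅ x ⁆ ⟨
  ∣ ⁅ x ⁆ ∣ + ∣ ∁ ⁅ x ⁆ ∣     ≡⟨ +-comm ∣ ⁅ x ⁆ ∣ _ ⟩
  ∣ ∁ ⁅ x ⁆ ∣ + ∣ ⁅ x ⁆ ∣     ≡⟨ cong (λ s → ∣ ∁ ⁅ x ⁆ ∣ + s) (∣⁅x⁆∣≡1 x) ⟩
  ∣ ∁ ⁅ x ⁆ ∣ + 1             ≤⟨ +-monoʳ-≤ ∣ ∁ ⁅ x ⁆ ∣ (s≤s z≤n) ⟩
  ∣ ∁ ⁅ x ⁆ ∣ + suc j         ∎)
  where open ≤-Reasoning

unique-nearFull : ∀ m j → Unique (nearFull m j)
unique-nearFull zero    j       = [] ∷ []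
unique-nearFull (suc m) zero    = Unique.map⁺ ∷-injectiveʳ (unique-nearFull m zero)
unique-nearFull (suc m) (suc j) = Unique.++⁺
  (Unique.map⁺ ∷-injectiveʳ (unique-nearFull m (suc j)))
  (Unique.map⁺ ∷-injectiveʳ (unique-nearFull m j))
  λ (A∈ˡ , A∈ʳ) → disjoint (∈-map⁻ _ A∈ˡ) (∈-map⁻ _ A∈ʳ)
  where
  disjoint : ∀ {A} → ∃[ B ] (B ∈ᶠ nearFull m (suc j) × A ≡ inside ∷ B) →
             ∃[ C ] (C ∈ᶠ nearFull m j × A ≡ outside ∷ C) → ⊥₀
  disjoint (_ , _ , refl) (_ , _ , ())

∪-nearFull : ∀ {m} j {X Y : Subset m} → X ∈ᶠ nearFull m j → Y ∈ᶠ nearFull m j → X ∪ Y ∈ᶠ nearFull m j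
∪-nearFull j {X} {Y} X∈ _ = ∈-nearFull⁺ j (≤-trans (∈-nearFull⁻ j X∈) (+-monoˡ-≤ j (∣p∣≤∣p∪q∣ X Y)))

lookup-∁⁅x⁆-x : ∀ {m} (x : Fin m) → Vec.lookup (∁ ⁅ x ⁆) x ≡ outside
lookup-∁⁅x⁆-x zero    = refl
lookup-∁⁅x⁆-x (suc x) = lookup-∁⁅x⁆-x x

lookup-∁⁅x⁆-y : ∀ {m} (x y : Fin m) → x ≢ y → Vec.lookup (∁ ⁅ x ⁆) y ≡ inside
lookup-∁⁅x⁆-y zero    zero    x≢y = contradiction refl x≢y
lookup-∁⁅x⁆-y zero    (suc y) _   = lookup-∁⊥ y
  where
  lookup-∁⊥ : ∀ {m} (y : Fin m) → Vec.lookup (∁ ⊥) y ≡ inside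
  lookup-∁⊥ zero    = refl
  lookup-∁⊥ (suc y) = lookup-∁⊥ y
lookup-∁⁅x⁆-y (suc x) zero    _   = refl
lookup-∁⁅x⁆-y (suc x) (suc y) x≢y = lookup-∁⁅x⁆-y x y (x≢y ∘ cong suc)

splits-nearFull : ∀ {m} j (x y : Fin m) → x ≢ y → Splits (nearFull m (suc j)) x y
splits-nearFull j x y x≢y = ∁ ⁅ x ⁆ , ∁⁅x⁆∈nearFull x j ,
  λ eq → contradiction (trans (sym (lookup-∁⁅x⁆-x x)) (trans eq (lookup-∁⁅x⁆-y x y x≢y))) λ ()

-- A spine of the small members

-- The sets missing exactly the first i points, for i from 0 to the smaller of `m` and `j`.
staircase : ∀ m → ℕ → Family m
staircase zero    j       = [ ⊤ ]
staircase (suc m) zero    = [ ⊤ ]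
staircase (suc m) (suc j) = ⊤ ∷ map (outside ∷_) (staircase m j)

length-staircase : ∀ {m j} → j ≤ m → length (staircase m j) ≡ suc j
length-staircase {zero}  z≤n     = refl
length-staircase {suc m} z≤n     = refl
length-staircase {suc m} (s≤s h) = cong suc (trans (length-map _ (staircase m _)) (length-staircase h))

descending-outside : ∀ {n} {𝓒 : Family n} → AllPairs _⊃_ 𝓒 → AllPairs _⊃_ (⊤ ∷ map (outside ∷_) 𝓒)
descending-outside ps = All.map⁺ (All.tabulate (λ _ → out⊂in ⊆⊤)) ∷ AllPairs.map⁺ (AllPairs.map s⊂s ps)

staircase-spine : ∀ m j → Spine (staircase m j) (nearFull m j)
staircase-spine m j = record
  { descending = descending m j
  ; included   = ∈-nearFull⁺ j ∘ included m j
  ; sizes      = λ {A} A∈ → sizes m j (∣p∣≤n A) (∈-nearFull⁻ j A∈) }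
  where
  descending : ∀ m j → AllPairs _⊃_ (staircase m j)
  descending zero    j       = [] ∷ []
  descending (suc m) zero    = [] ∷ []
  descending (suc m) (suc j) = descending-outside (descending m j)

  included : ∀ m j {C} → C ∈ᶠ staircase m j → m ≤ ∣ C ∣ + j
  included zero    j       _           = z≤n
  included (suc m) zero    (here refl) = ∈-nearFull⁻ zero (⊤∈nearFull (suc m) zero)
  included (suc m) (suc j) (here refl) = ∈-nearFull⁻ (suc j) (⊤∈nearFull (suc m) (suc j))
  included (suc m) (suc j) (there C∈) with ∈-map⁻ _ C∈
  ... | D , D∈ , refl = subst (suc m ≤_) (sym (+-suc ∣ D ∣ j)) (s≤s (included m j D∈))

  -- Stated for a bare size `c`: a set of that size may contain the first point, so the set itself
  -- cannot be passed down the recursion.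
  sizes : ∀ m j {c} → c ≤ m → m ≤ c + j → c ∈ᶠ map ∣_∣ (staircase m j)
  sizes zero    j       z≤n _ = here refl
  sizes (suc m) zero {c} c≤ m≤ = here (trans (≤-antisym c≤ (subst (suc m ≤_) (+-identityʳ c) m≤)) (sym (∣⊤∣≡n (suc m))))
  sizes (suc m) (suc j) {c} c≤ m≤ with m≤n⇒m<n∨m≡n c≤
  ... | inj₂ refl      = here (sym (∣⊤∣≡n (suc m)))
  ... | inj₁ (s≤s c≤m) = there (subst (c ∈ᶠ_) (map-∘ (staircase m j))
                                 (sizes m j c≤m (ℕ.s≤s⁻¹ (subst (suc m ≤_) (+-suc c j) m≤))))

-- Binomial counts for the small members

-- Pascal's rule, summed over the first entries of a row.
length-nearFull-suc : ∀ m j → length (nearFull (suc m) (suc j)) ≡ length (nearFull m (suc j)) + length (nearFull m j)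
length-nearFull-suc m j = trans (length-++ (map (inside ∷_) (nearFull m (suc j))))
  (cong₂ _+_ (length-map _ (nearFull m (suc j))) (length-map _ (nearFull m j)))

missing-nearFull-suc : ∀ m j → missing (nearFull (suc m) (suc j)) ≡
                       missing (nearFull m (suc j)) + (length (nearFull m j) + missing (nearFull m j))
missing-nearFull-suc m j = trans (missing-++ (map (inside ∷_) (nearFull m (suc j))) _)
  (cong₂ _+_ (missing-inside (nearFull m (suc j))) (missing-outside (nearFull m j)))

1≤length-nearFull : ∀ m j → 1 ≤ length (nearFull m j)
1≤length-nearFull zero    j       = s≤s z≤n
1≤length-nearFull (suc m) zero    = subst (1 ≤_) (sym (length-map _ (nearFull m zero))) (1≤length-nearFull m zero)
1≤length-nearFull (suc m) (suc j) = subst (1 ≤_) (sym (length-nearFull-suc m j))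
  (≤-trans (1≤length-nearFull m (suc j)) (m≤m+n _ _))

-- The full set and the `m` sets missing one point. The linear bounds are the increments in the
-- inductions for the quadratic ones.
m+1≤length-nearFull : ∀ m j → m + 1 ≤ length (nearFull m (suc j))
m+1≤length-nearFull zero    j = s≤s z≤n
m+1≤length-nearFull (suc m) j = begin
  suc m + 1                                             ≡⟨ +-comm 1 (m + 1) ⟩
  m + 1 + 1                                             ≤⟨ +-mono-≤ (m+1≤length-nearFull m j) (1≤length-nearFull m j) ⟩
  length (nearFull m (suc j)) + length (nearFull m j)   ≡⟨ length-nearFull-suc m j ⟨
  length (nearFull (suc m) (suc j))                     ∎
  where open ≤-Reasoning

m≤missing-nearFull : ∀ m j → m ≤ missing (nearFull m (suc j))
m≤missing-nearFull zero    j = z≤n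
m≤missing-nearFull (suc m) j = begin
  suc m   ≡⟨ +-comm 1 m ⟩
  m + 1   ≤⟨ +-mono-≤ (m≤missing-nearFull m j) (≤-trans (1≤length-nearFull m j) (m≤m+n _ _)) ⟩
  missing (nearFull m (suc j)) + (length (nearFull m j) + missing (nearFull m j)) ≡⟨ missing-nearFull-suc m j ⟨
  missing (nearFull (suc m) (suc j))   ∎
  where open ≤-Reasoning

-- The left side is twice 1 + m + m(m - 1)/2, the exact count at `j = 0`, where at most two points
-- are missing.
m*m+m+2≤2*length-nearFull : ∀ m j → m * m + m + 2 ≤ 2 * length (nearFull m (2 + j))
m*m+m+2≤2*length-nearFull zero    j = ≤-refl
m*m+m+2≤2*length-nearFull (suc m) j = begin
  suc m * suc m + suc m + 2               ≡⟨ expand m ⟩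
  (m * m + m + 2) + 2 * (m + 1)           ≤⟨ +-mono-≤ (m*m+m+2≤2*length-nearFull m j) (*-monoʳ-≤ 2 (m+1≤length-nearFull m j)) ⟩
  2 * length (nearFull m (2 + j)) + 2 * length (nearFull m (suc j))   ≡⟨ *-distribˡ-+ 2 (length (nearFull m (2 + j))) _ ⟨
  2 * (length (nearFull m (2 + j)) + length (nearFull m (suc j)))     ≡⟨ cong (2 *_) (length-nearFull-suc m (suc j)) ⟨
  2 * length (nearFull (suc m) (2 + j))   ∎
  where
  open ≤-Reasoning
  expand : ∀ m → suc m * suc m + suc m + 2 ≡ (m * m + m + 2) + 2 * (m + 1)
  expand = solve-∀

-- At `j = 0` the exact total is m + 2 · m(m - 1)/2, from the sets missing one and two points.
m*m≤missing-nearFull : ∀ m j → m * m ≤ missing (nearFull m (2 + j))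
m*m≤missing-nearFull zero    j = z≤n
m*m≤missing-nearFull (suc m) j = begin
  suc m * suc m               ≡⟨ expand m ⟩
  m * m + ((m + 1) + m)       ≤⟨ +-mono-≤ (m*m≤missing-nearFull m j) (+-mono-≤ (m+1≤length-nearFull m j) (m≤missing-nearFull m j)) ⟩
  missing (nearFull m (2 + j)) + (length (nearFull m (suc j)) + missing (nearFull m (suc j))) ≡⟨ missing-nearFull-suc m (suc j) ⟨
  missing (nearFull (suc m) (2 + j))   ∎
  where
  open ≤-Reasoning
  expand : ∀ m → suc m * suc m ≡ m * m + ((m + 1) + m)
  expand = solve-∀

-- Large members: their traces on N

-- The `inside` of the base case keeps point r + 1 in every member, so none is empty, and there are
-- exactly as many members as points.
tower : ∀ r p → Family (r + suc p)
tower zero    p = map (inside ∷_) (nearFull p 1)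
tower (suc r) p = ⊤ ∷ map (outside ∷_) (tower r p)

⊤∈tower : ∀ r p → ⊤ ∈ᶠ tower r p
⊤∈tower zero    p = ∈-map⁺ _ (⊤∈nearFull p 1)
⊤∈tower (suc r) p = here refl

-- Gives every large member at least m + 1 points, which keeps it apart from the small ones and out
-- of the sets below n/2.
tower-nonempty : ∀ r p {A} → A ∈ᶠ tower r p → 1 ≤ ∣ A ∣
tower-nonempty zero p A∈ with ∈-map⁻ _ A∈
... | _ , _ , refl = s≤s z≤n
tower-nonempty (suc r) p (here refl) = s≤s z≤n
tower-nonempty (suc r) p (there A∈) with ∈-map⁻ _ A∈
... | _ , B∈ , refl = tower-nonempty r p B∈

unique-tower : ∀ r p → Unique (tower r p)
unique-tower zero    p = Unique.map⁺ ∷-injectiveʳ (unique-nearFull p 1)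
unique-tower (suc r) p = All.map⁺ (All.tabulate (λ _ ())) ∷ Unique.map⁺ ∷-injectiveʳ (unique-tower r p)

∪-tower : ∀ r p {X Y} → X ∈ᶠ tower r p → Y ∈ᶠ tower r p → X ∪ Y ∈ᶠ tower r p
∪-tower zero p X∈ Y∈ with ∈-map⁻ _ X∈ | ∈-map⁻ _ Y∈
... | _ , A∈ , refl | _ , B∈ , refl = ∈-map⁺ _ (∪-nearFull 1 A∈ B∈)
∪-tower (suc r) p {Y = Y} (here refl) _           = here (∪-zeroˡ Y)
∪-tower (suc r) p {X}     (there _)   (here refl) = here (∪-zeroʳ X)
∪-tower (suc r) p (there X∈) (there Y∈) with ∈-map⁻ _ X∈ | ∈-map⁻ _ Y∈
... | _ , A∈ , refl | _ , B∈ , refl = there (∈-map⁺ _ (∪-tower r p A∈ B∈))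

splits-tower : ∀ r p x y → x ≢ y → Splits (tower r p) x y
splits-tower zero p zero    zero    x≢y = contradiction refl x≢y
-- The point common to all members is told apart from `y` by the set missing only `y`.
splits-tower zero p zero    (suc y) _   = inside ∷ ∁ ⁅ y ⁆ , ∈-map⁺ _ (∁⁅x⁆∈nearFull y 0) ,
  λ eq → contradiction (trans eq (lookup-∁⁅x⁆-x y)) λ ()
splits-tower zero p (suc x) zero    _   = Splits-sym (splits-tower zero p zero (suc x) λ ())
splits-tower zero p (suc x) (suc y) x≢y with splits-nearFull 0 x y (x≢y ∘ cong suc)
... | A , A∈ , ne = inside ∷ A , ∈-map⁺ _ A∈ , ne
splits-tower (suc r) p zero    zero    x≢y = contradiction refl x≢y
splits-tower (suc r) p zero    (suc y) _   = outside ∷ ⊤ , there (∈-map⁺ _ (⊤∈tower r p)) ,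
  λ eq → contradiction (trans eq (lookup-replicate y inside)) λ ()
splits-tower (suc r) p (suc x) zero    _   = Splits-sym (splits-tower (suc r) p zero (suc x) λ ())
splits-tower (suc r) p (suc x) (suc y) x≢y with splits-tower r p x y (x≢y ∘ cong suc)
... | A , A∈ , ne = outside ∷ A , there (∈-map⁺ _ A∈) , ne

length-nearFull-0 : ∀ m → length (nearFull m 0) ≡ 1
length-nearFull-0 zero    = refl
length-nearFull-0 (suc m) = trans (length-map _ (nearFull m 0)) (length-nearFull-0 m)

length-nearFull-1 : ∀ m → length (nearFull m 1) ≡ suc m
length-nearFull-1 zero    = refl
length-nearFull-1 (suc m) = trans (length-nearFull-suc m 0)
  (trans (cong₂ _+_ (length-nearFull-1 m) (length-nearFull-0 m)) (+-comm (suc m) 1))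

length-tower : ∀ r p → length (tower r p) ≡ r + suc p
length-tower zero    p = trans (length-map _ (nearFull p 1)) (length-nearFull-1 p)
length-tower (suc r) p = cong suc (trans (length-map _ (tower r p)) (length-tower r p))

-- Every member except `⊤` misses at least one point.
size≤missing-tower : ∀ r p → r + suc p ≤ suc (missing (tower r p))
size≤missing-tower zero    p = s≤s (subst (p ≤_) (sym (missing-inside (nearFull p 1))) (m≤missing-nearFull p 0))
size≤missing-tower (suc r) p = s≤s (begin
  r + suc p                                    ≡⟨ length-tower r p ⟨
  length (tower r p)                           ≤⟨ m≤m+n _ _ ⟩
  length (tower r p) + missing (tower r p)     ≡⟨ missing-outside (tower r p) ⟨
  missing (map (outside ∷_) (tower r p))       ≤⟨ m≤n+m _ _ ⟩
  missing (tower (suc r) p)                    ∎)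
  where open ≤-Reasoning

-- A spine of the tower

towerSpine : ∀ r p → Family (r + suc p)
towerSpine zero    p = map (inside ∷_) (staircase p 1)
towerSpine (suc r) p = ⊤ ∷ map (outside ∷_) (towerSpine r p)

-- The argument is `suc p` because the last step of the chain removes one of the final points, so
-- one must exist.
length-towerSpine : ∀ r p → length (towerSpine r (suc p)) ≡ 2 + r
length-towerSpine zero    p = trans (length-map _ (staircase (suc p) 1)) (length-staircase {suc p} (s≤s z≤n))
length-towerSpine (suc r) p = cong suc (trans (length-map _ (towerSpine r (suc p))) (length-towerSpine r p))

-- Carries a realised size along an embedding `h` that acts on sizes by `k`: a successor, the
-- identity, or addition of `m`.
∈-map-via : ∀ {a b c} {A : Set a} {B : Set b} {C : Set c} {f : A → C} {g : B → C} {h : A → B} {k : C → C} →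
            (∀ x → g (h x) ≡ k (f x)) → ∀ {c xs} → c ∈ᶠ map f xs → k c ∈ᶠ map g (map h xs)
∈-map-via {g = g} {h} {k} eq c∈ with ∈-map⁻ _ c∈
... | x , x∈ , refl = subst (_∈ᶠ _) (eq x) (∈-map⁺ g (∈-map⁺ h x∈))

towerSpine-spine : ∀ r p → Spine (towerSpine r p) (tower r p)
towerSpine-spine zero p = record
  { descending = AllPairs.map⁺ (AllPairs.map s⊂s (Spine.descending base))
  ; included   = ⊆ᶠ.map⁺ _ (Spine.included base)
  ; sizes      = λ A∈ → sizes (∈-map⁻ _ A∈) }
  where
  base = staircase-spine p 1
  sizes : ∀ {A} → ∃[ B ] (B ∈ᶠ nearFull p 1 × A ≡ inside ∷ B) → ∣ A ∣ ∈ᶠ map ∣_∣ (towerSpine zero p)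
  sizes (_ , B∈ , refl) = ∈-map-via {k = suc} (λ _ → refl) (Spine.sizes base B∈)
towerSpine-spine (suc r) p = record
  { descending = descending-outside (Spine.descending base)
  ; included   = ⊆ᶠ.∷⁺ʳ _ (⊆ᶠ.map⁺ _ (Spine.included base))
  ; sizes      = sizes }
  where
  base = towerSpine-spine r p
  sizes : ∀ {A} → A ∈ᶠ tower (suc r) p → ∣ A ∣ ∈ᶠ map ∣_∣ (towerSpine (suc r) p)
  sizes (here refl) = here refl
  sizes (there A∈) with ∈-map⁻ _ A∈
  ... | _ , B∈ , refl = there (∈-map-via {k = λ c → c} (λ _ → refl) (Spine.sizes base B∈))

-- Sizes and inclusions of concatenations

∣++∣ : ∀ {q m} (T : Subset q) (S : Subset m) → ∣ T Vec.++ S ∣ ≡ ∣ T ∣ + ∣ S ∣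
∣++∣ []            S = refl
∣++∣ (inside  ∷ T) S = cong suc (∣++∣ T S)
∣++∣ (outside ∷ T) S = ∣++∣ T S

∣∁++∣ : ∀ {q m} (T : Subset q) (S : Subset m) → ∣ ∁ (T Vec.++ S) ∣ ≡ ∣ ∁ T ∣ + ∣ ∁ S ∣
∣∁++∣ []            S = refl
∣∁++∣ (inside  ∷ T) S = ∣∁++∣ T S
∣∁++∣ (outside ∷ T) S = cong suc (∣∁++∣ T S)

∣∁⊤∣≡0 : ∀ n → ∣ ∁ (⊤ {n}) ∣ ≡ 0
∣∁⊤∣≡0 zero    = refl
∣∁⊤∣≡0 (suc n) = ∣∁⊤∣≡0 n

∣∁⊥∣≡n : ∀ n → ∣ ∁ (⊥ {n}) ∣ ≡ n
∣∁⊥∣≡n zero    = refl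
∣∁⊥∣≡n (suc n) = cong suc (∣∁⊥∣≡n n)

⊤++⊤ : ∀ q {m} → ⊤ {q} Vec.++ ⊤ {m} ≡ ⊤
⊤++⊤ zero    = refl
⊤++⊤ (suc q) = cong (inside ∷_) (⊤++⊤ q)

-- Lets proper inclusion of concatenations be shown by counting, with no witness traced across the
-- two blocks.
⊆∧<⇒⊂ : ∀ {n} {p q : Subset n} → p ⊆ q → ∣ p ∣ ℕ.< ∣ q ∣ → p ⊂ q
⊆∧<⇒⊂ {p = []}          {[]}          _   ()
⊆∧<⇒⊂ {p = inside  ∷ p} {inside  ∷ q} p⊆q lt = s⊂s (⊆∧<⇒⊂ (drop-∷-⊆ p⊆q) (ℕ.s≤s⁻¹ lt))
⊆∧<⇒⊂ {p = outside ∷ p} {outside ∷ q} p⊆q lt = s⊂s (⊆∧<⇒⊂ (drop-∷-⊆ p⊆q) lt)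
⊆∧<⇒⊂ {p = inside  ∷ p} {outside ∷ q} p⊆q _  = contradiction (p⊆q here) λ ()
⊆∧<⇒⊂ {p = outside ∷ p} {inside  ∷ q} p⊆q _  = out⊂in (drop-∷-⊆ p⊆q)

++-mono-⊆ : ∀ {q m} {T T′ : Subset q} {S S′ : Subset m} → T ⊆ T′ → S ⊆ S′ → T Vec.++ S ⊆ T′ Vec.++ S′
++-mono-⊆ {T = []}          {[]}         _  S⊆ = S⊆
++-mono-⊆ {T = outside ∷ T} {_ ∷ _}       T⊆ S⊆ = out⊆ (++-mono-⊆ (drop-∷-⊆ T⊆) S⊆)
++-mono-⊆ {T = inside  ∷ T} {inside ∷ _}  T⊆ S⊆ = s⊆s (++-mono-⊆ (drop-∷-⊆ T⊆) S⊆)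
++-mono-⊆ {T = inside  ∷ T} {outside ∷ _} T⊆ S⊆ = contradiction (T⊆ here) λ ()

∣⊥++S∣≡∣S∣ : ∀ q {m} (S : Subset m) → ∣ ⊥ {q} Vec.++ S ∣ ≡ ∣ S ∣
∣⊥++S∣≡∣S∣ q S = trans (∣++∣ (⊥ {q}) S) (cong (_+ ∣ S ∣) (∣⊥∣≡0 q))

∣T++⊤∣≡m+∣T∣ : ∀ {q} m (T : Subset q) → ∣ T Vec.++ ⊤ {m} ∣ ≡ m + ∣ T ∣
∣T++⊤∣≡m+∣T∣ m T = trans (∣++∣ T ⊤) (trans (cong (λ s → ∣ T ∣ + s) (∣⊤∣≡n m)) (+-comm ∣ T ∣ m))

-- Stacking the large members on the small ones

infixr 5 _⊞_

_⊞_ : ∀ {q m} → Family q → Family m → Family (q + m)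
𝓣 ⊞ 𝓢 = map (Vec._++ ⊤) 𝓣 ++ map (⊥ Vec.++_) 𝓢

module _ {q m} {𝓣 : Family q} {𝓢 : Family m} where

  ⊞⁺ˡ : ∀ {T} → T ∈ᶠ 𝓣 → T Vec.++ ⊤ ∈ᶠ 𝓣 ⊞ 𝓢
  ⊞⁺ˡ T∈ = ∈-++⁺ˡ (∈-map⁺ _ T∈)

  ⊞⁺ʳ : ∀ {S} → S ∈ᶠ 𝓢 → ⊥ Vec.++ S ∈ᶠ 𝓣 ⊞ 𝓢
  ⊞⁺ʳ S∈ = ∈-++⁺ʳ (map (Vec._++ ⊤) 𝓣) (∈-map⁺ _ S∈)

  data View : Subset (q + m) → Set where
    large : ∀ {T} → T ∈ᶠ 𝓣 → View (T Vec.++ ⊤)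
    small : ∀ {S} → S ∈ᶠ 𝓢 → View (⊥ Vec.++ S)

  view : ∀ {A} → A ∈ᶠ 𝓣 ⊞ 𝓢 → View A
  view A∈ with ∈-++⁻ (map (Vec._++ ⊤) 𝓣) A∈
  ... | inj₁ A∈ˡ with ∈-map⁻ _ A∈ˡ
  ...   | _ , T∈ , refl = large T∈
  view A∈ | inj₂ A∈ʳ with ∈-map⁻ _ A∈ʳ
  ...   | _ , S∈ , refl = small S∈

  ⊤∈⊞ : ⊤ ∈ᶠ 𝓣 → ⊤ ∈ᶠ 𝓣 ⊞ 𝓢
  ⊤∈⊞ ⊤∈ = subst (_∈ᶠ 𝓣 ⊞ 𝓢) (⊤++⊤ q) (⊞⁺ˡ ⊤∈)

  unique-⊞ : Unique 𝓣 → Unique 𝓢 → (∀ {T} → T ∈ᶠ 𝓣 → 1 ≤ ∣ T ∣) → Unique (𝓣 ⊞ 𝓢)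
  unique-⊞ u𝓣 u𝓢 pos = Unique.++⁺
    (Unique.map⁺ (λ {T} {T′} → ++-injectiveˡ T T′) u𝓣)
    (Unique.map⁺ (++-injectiveʳ ⊥ ⊥) u𝓢)
    λ (A∈ˡ , A∈ʳ) → disjoint (∈-map⁻ _ A∈ˡ) (∈-map⁻ _ A∈ʳ)
    where
    disjoint : ∀ {A} → ∃[ T ] (T ∈ᶠ 𝓣 × A ≡ T Vec.++ ⊤) → ∃[ S ] (S ∈ᶠ 𝓢 × A ≡ ⊥ Vec.++ S) → ⊥₀
    disjoint (T , T∈ , refl) (_ , _ , eq) = contradiction
      (subst (1 ≤_) (trans (cong ∣_∣ (++-injectiveˡ T ⊥ eq)) (∣⊥∣≡0 q)) (pos T∈)) λ ()

  -- A large member contains every small one, so a mixed union is the large member again.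
  ∪-⊞ : (∀ {X Y} → X ∈ᶠ 𝓣 → Y ∈ᶠ 𝓣 → X ∪ Y ∈ᶠ 𝓣) → (∀ {X Y} → X ∈ᶠ 𝓢 → Y ∈ᶠ 𝓢 → X ∪ Y ∈ᶠ 𝓢) →
        ∀ {X Y} → X ∈ᶠ 𝓣 ⊞ 𝓢 → Y ∈ᶠ 𝓣 ⊞ 𝓢 → X ∪ Y ∈ᶠ 𝓣 ⊞ 𝓢
  ∪-⊞ ∪𝓣 ∪𝓢 X∈ Y∈ with view X∈ | view Y∈
  ... | large {T} T∈ | large {T′} T′∈ = subst (_∈ᶠ 𝓣 ⊞ 𝓢)
        (sym (trans (zipWith-++ _ T ⊤ T′ ⊤) (cong (T ∪ T′ Vec.++_) (∪-zeroˡ ⊤)))) (⊞⁺ˡ (∪𝓣 T∈ T′∈))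
  ... | large {T} T∈ | small {S} S∈   = subst (_∈ᶠ 𝓣 ⊞ 𝓢)
        (sym (trans (zipWith-++ _ T ⊤ ⊥ S) (cong₂ Vec._++_ (∪-identityʳ T) (∪-zeroˡ S)))) X∈
  ... | small {S} S∈ | large {T} T∈   = subst (_∈ᶠ 𝓣 ⊞ 𝓢)
        (sym (trans (zipWith-++ _ ⊥ S T ⊤) (cong₂ Vec._++_ (∪-identityˡ T) (∪-zeroʳ S)))) Y∈
  ... | small {S} S∈ | small {S′} S′∈ = subst (_∈ᶠ 𝓣 ⊞ 𝓢)
        (sym (trans (zipWith-++ _ ⊥ S ⊥ S′) (cong (Vec._++ S ∪ S′) (∪-identityˡ ⊥)))) (⊞⁺ʳ (∪𝓢 S∈ S′∈))

  splits-⊞ : ⊤ ∈ᶠ 𝓢 → (∀ x y → x ≢ y → Splits 𝓣 x y) → (∀ x y → x ≢ y → Splits 𝓢 x y) →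
             ∀ x y → x ≢ y → Splits (𝓣 ⊞ 𝓢) x y
  splits-⊞ ⊤∈𝓢 splits𝓣 splits𝓢 x y x≢y = subst₂ (Splits (𝓣 ⊞ 𝓢)) (join-splitAt q m x) (join-splitAt q m y)
    (go (splitAt q x) (splitAt q y)
      λ eq → x≢y (trans (sym (join-splitAt q m x)) (trans (cong (join q m) eq) (join-splitAt q m y))))
    where
    -- Points of different blocks are separated by the set M itself.
    cross : ∀ i j → Splits (𝓣 ⊞ 𝓢) (i ↑ˡ m) (q ↑ʳ j)
    cross i j = ⊥ {q} Vec.++ ⊤ {m} , ⊞⁺ʳ ⊤∈𝓢 , λ eq → contradiction
      (trans (sym (trans (lookup-++ˡ (⊥ {q}) (⊤ {m}) i) (lookup-replicate i outside)))
        (trans eq (trans (lookup-++ʳ (⊥ {q}) ⊤ j) (lookup-replicate j inside)))) λ ()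

    go : ∀ s t → s ≢ t → Splits (𝓣 ⊞ 𝓢) (join q m s) (join q m t)
    go (inj₁ i) (inj₁ j) s≢t with splits𝓣 i j (s≢t ∘ cong inj₁)
    ... | T , T∈ , ne = T Vec.++ ⊤ , ⊞⁺ˡ T∈ ,
          λ eq → ne (trans (sym (lookup-++ˡ T (⊤ {m}) i)) (trans eq (lookup-++ˡ T ⊤ j)))
    go (inj₁ i) (inj₂ j) _ = cross i j
    go (inj₂ i) (inj₁ j) _ = Splits-sym (cross j i)
    go (inj₂ i) (inj₂ j) s≢t with splits𝓢 i j (s≢t ∘ cong inj₂)
    ... | S , S∈ , ne = ⊥ Vec.++ S , ⊞⁺ʳ S∈ ,
          λ eq → ne (trans (sym (lookup-++ʳ (⊥ {q}) S i)) (trans eq (lookup-++ʳ (⊥ {q}) S j)))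

length-⊞ : ∀ {q m} (𝓣 : Family q) (𝓢 : Family m) → length (𝓣 ⊞ 𝓢) ≡ length 𝓣 + length 𝓢
length-⊞ 𝓣 𝓢 = trans (length-++ (map (Vec._++ ⊤) 𝓣)) (cong₂ _+_ (length-map _ 𝓣) (length-map _ 𝓢))

-- Large members miss nothing in the second block, small ones miss the whole first block.
missing-⊞ : ∀ {q m} (𝓣 : Family q) (𝓢 : Family m) → missing (𝓣 ⊞ 𝓢) ≡ missing 𝓣 + (q * length 𝓢 + missing 𝓢)
missing-⊞ {q} {m} 𝓣 𝓢 = trans (missing-++ (map (Vec._++ ⊤) 𝓣) _) (cong₂ _+_
  (missing-map (Vec._++ ⊤) 0 (λ T → trans (∣∁++∣ T ⊤) (trans (cong (λ s → ∣ ∁ T ∣ + s) (∣∁⊤∣≡0 m)) (+-identityʳ _))) 𝓣)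
  (missing-map (⊥ Vec.++_) q (λ S → trans (∣∁++∣ (⊥ {q}) S) (cong (_+ ∣ ∁ S ∣) (∣∁⊥∣≡n q))) 𝓢))

-- Heights add: as each `T` is nonempty, every large member strictly contains every small one, so
-- the two chains concatenate.
spine-⊞ : ∀ {q m} {𝓣 𝓒 : Family q} {𝓢 𝓓 : Family m} → (∀ {T} → T ∈ᶠ 𝓣 → 1 ≤ ∣ T ∣) →
          Spine 𝓒 𝓣 → Spine 𝓓 𝓢 → Spine (𝓒 ⊞ 𝓓) (𝓣 ⊞ 𝓢)
spine-⊞ {q} {m} {𝓣} {𝓒} {𝓢} {𝓓} pos spine𝓣 spine𝓢 = record
  { descending = AllPairs.++⁺
      (AllPairs.map⁺ (AllPairs.map (λ {T} {T′} T′⊂T → ⊆∧<⇒⊂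
        (++-mono-⊆ {T = T′} {T} {⊤} (p⊂q⇒p⊆q T′⊂T) (λ x → x))
        (subst₂ ℕ._<_ (sym (∣++∣ T′ (⊤ {m}))) (sym (∣++∣ T ⊤)) (+-monoˡ-< _ (p⊂q⇒∣p∣<∣q∣ T′⊂T)))) 𝓒↓))
      (AllPairs.map⁺ (AllPairs.map (λ {S} {S′} S′⊂S → ⊆∧<⇒⊂
        (++-mono-⊆ {T = ⊥ {q}} {⊥} {S′} {S} (λ x → x) (p⊂q⇒p⊆q S′⊂S))
        (subst₂ ℕ._<_ (sym (∣⊥++S∣≡∣S∣ q S′)) (sym (∣⊥++S∣≡∣S∣ q S)) (p⊂q⇒∣p∣<∣q∣ S′⊂S))) 𝓓↓))
      (All.map⁺ (All.tabulate λ {T} T∈ → All.map⁺ (All.tabulate λ {S} _ → ⊆∧<⇒⊂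
        (++-mono-⊆ {T = ⊥ {q}} {T} {S} ⊥⊆ ⊆⊤)
        (subst₂ ℕ._<_ (sym (∣⊥++S∣≡∣S∣ q S)) (sym (∣T++⊤∣≡m+∣T∣ m T))
          (≤-<-trans (∣p∣≤n S) (m<m+n m (pos (Spine.included spine𝓣 T∈))))))))
  ; included   = ⊆ᶠ.++⁺ (⊆ᶠ.map⁺ _ (Spine.included spine𝓣)) (⊆ᶠ.map⁺ _ (Spine.included spine𝓢))
  ; sizes      = sizes ∘ view }
  where
  𝓒↓ = Spine.descending spine𝓣
  𝓓↓ = Spine.descending spine𝓢

  split : map ∣_∣ (𝓒 ⊞ 𝓓) ≡ map ∣_∣ (map (Vec._++ ⊤) 𝓒) ++ map ∣_∣ (map (⊥ Vec.++_) 𝓓)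
  split = map-++ ∣_∣ (map (Vec._++ ⊤) 𝓒) _

  sizes : ∀ {A} → View {𝓣 = 𝓣} {𝓢} A → ∣ A ∣ ∈ᶠ map ∣_∣ (𝓒 ⊞ 𝓓)
  sizes (large {T} T∈) = subst₂ _∈ᶠ_ (sym (∣T++⊤∣≡m+∣T∣ m T)) (sym split)
    (∈-++⁺ˡ (∈-map-via {k = λ c → m + c} (∣T++⊤∣≡m+∣T∣ m) (Spine.sizes spine𝓣 T∈)))
  sizes (small {S} S∈) = subst₂ _∈ᶠ_ (sym (∣⊥++S∣≡∣S∣ q S)) (sym split)
    (∈-++⁺ʳ _ (∈-map-via {k = λ c → c} (∣⊥++S∣≡∣S∣ q) (Spine.sizes spine𝓢 S∈)))


-- The inequality behind the average

-- Here `t` and `c` are the points missed within N by the large and within M by the small members,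
-- and `l` counts the small ones. The coefficients of `l` differ by 2q - (q + m) = d > 0 in favour
-- of the right side, so lower bounds on all three suffice.
missing-bound : ∀ {d} w {l t c} → d ≡ 1 ⊎ d ≡ 2 → let m = 4 + w ; q = d + m in
  q ≤ suc t → m * m + m + 2 ≤ 2 * l → m * m ≤ c →
  (q + m) * (q + l) ℕ.< 2 * (t + (q * l + c))
missing-bound {d} w {l} {t} {c} d≡ t≥ l≥ c≥
  -- Slack variables turn the bounds into equations, leaving a polynomial identity with nonnegative
  -- remainder.
  with m≤n⇒∃[o]m+o≡n t≥ | m≤n⇒∃[o]m+o≡n l≥ | m≤n⇒∃[o]m+o≡n c≥
-- Doubling produces the `2 * l` of the bound; adding 4 turns `4 * t` into `4 * suc t`.
... | z , eqz | x , eqx | y , refl = *-cancelˡ-< 2 _ _ (+-cancelʳ-< 4 _ _ (begin-strict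
  2 * ((q + m) * (q + l)) + 4                          ≡⟨ left q m l ⟩
  2 * ((q + m) * q) + (q + m) * (2 * l) + 4            ≡⟨ cong (λ L → 2 * ((q + m) * q) + (q + m) * L + 4) eqx ⟨
  2 * ((q + m) * q) + (q + m) * (m * m + m + 2 + x) + 4  <⟨ gap d≡ ⟩
  4 * (q + z) + 2 * q * (m * m + m + 2 + x) + 4 * (m * m + y)  ≡⟨ cong₂ (λ T L → 4 * T + 2 * q * L + 4 * (m * m + y)) eqz eqx ⟩
  4 * suc t + 2 * q * (2 * l) + 4 * (m * m + y)        ≡⟨ right q l t (m * m + y) ⟩
  2 * (2 * (t + (q * l + (m * m + y)))) + 4            ∎))
  where
  open ≤-Reasoning
  m = 4 + w
  q = d + m

  left : ∀ q m l → 2 * ((q + m) * (q + l)) + 4 ≡ 2 * ((q + m) * q) + (q + m) * (2 * l) + 4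
  left = solve-∀

  right : ∀ q l t c → 4 * suc t + 2 * q * (2 * l) + 4 * c ≡ 2 * (2 * (t + (q * l + c))) + 4
  right = solve-∀

  -- Twice the difference of the two sides is m² − m + x + 4y + 4z for d = 1
  -- and 2m² − 6m + 2x + 4y + 4z for d = 2; the latter is why m ≥ 4 is needed.
  gap₁ : ∀ w x y z → let m = 4 + w ; q = 1 + m in
    4 * (q + z) + 2 * q * (m * m + m + 2 + x) + 4 * (m * m + y) ≡
    suc (2 * ((q + m) * q) + (q + m) * (m * m + m + 2 + x) + 4) + (11 + 7 * w + w * w + x + 4 * y + 4 * z)
  gap₁ = solve-∀

  gap₂ : ∀ w x y z → let m = 4 + w ; q = 2 + m in
    4 * (q + z) + 2 * q * (m * m + m + 2 + x) + 4 * (m * m + y) ≡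
    suc (2 * ((q + m) * q) + (q + m) * (m * m + m + 2 + x) + 4) + (7 + 10 * w + 2 * (w * w) + 2 * x + 4 * y + 4 * z)
  gap₂ = solve-∀

  gap : d ≡ 1 ⊎ d ≡ 2 → 2 * ((q + m) * q) + (q + m) * (m * m + m + 2 + x) + 4 ℕ.<
                        4 * (q + z) + 2 * q * (m * m + m + 2 + x) + 4 * (m * m + y)
  gap (inj₁ refl) = m+n≤o⇒m≤o _ (≤-reflexive (sym (gap₁ w x y z)))
  gap (inj₂ refl) = m+n≤o⇒m≤o _ (≤-reflexive (sym (gap₂ w x y z)))

-- Assembling the family and choosing parameters

d≤2 : ∀ {d} → d ≡ 1 ⊎ d ≡ 2 → d ≤ 2
d≤2 (inj₁ refl) = s≤s z≤n
d≤2 (inj₂ refl) = ≤-refl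

Example : ℕ → ℕ → Set
Example n k = Σ[ 𝓐 ∈ Family n ] Σ[ uc ∈ UnionClosed 𝓐 ]
    (b 𝓐 ≡ ⊤ × Separating 𝓐 × HasHeight 𝓐 k × (∣𝓑 𝓐 ∣≡ 1) × Avg 𝓐 uc < half n)

-- Here `d` is q - m and `j` is `2 + i`; the height is left as the sum of the spine lengths r + 2
-- and j + 1.
construction : ∀ {d} w r p i → d ≡ 1 ⊎ d ≡ 2 → r + suc (suc p) ≡ d + (4 + w) → 2 + i ≤ 4 + w →
               Example (r + suc (suc p) + (4 + w)) (2 + r + suc (2 + i))
construction {d} w r p i d≡ q≡ j≤m =
  𝓐 , uc , ⊤∈⇒⋃≡⊤ (⊤∈⊞ (⊤∈tower r (suc p)))
  , splits⇒separating (splits-⊞ (⊤∈nearFull m j) (splits-tower r (suc p)) (splits-nearFull (suc i)))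
  , subst (HasHeight 𝓐) (trans (length-⊞ (towerSpine r (suc p)) (staircase m j)) (cong₂ _+_ (length-towerSpine r p) (length-staircase j≤m)))
      (spine⇒height (spine-⊞ (tower-nonempty r (suc p)) (towerSpine-spine r (suc p)) (staircase-spine m j)))
  , ∣𝓑∣≡1 M∈𝓐 M-nonempty
      (subst (λ s → 2 * s ℕ.< q + m) (sym (trans (∣⊥++S∣≡∣S∣ q (⊤ {m})) (∣⊤∣≡n m))) (2m<n d≡))
      (λ A∈ → below⊆M (view A∈))
  , Avg<half uc (begin-strict
      (q + m) * length 𝓐                                    ≡⟨ cong ((q + m) *_) (trans (length-⊞ 𝓣 𝓢) (cong (_+ length 𝓢) (length-tower r (suc p)))) ⟩
      (q + m) * (q + length 𝓢)                              <⟨ enough ⟩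
      2 * (missing 𝓣 + (q * length 𝓢 + missing 𝓢))          ≡⟨ cong (2 *_) (missing-⊞ 𝓣 𝓢) ⟨
      2 * missing 𝓐                                         ∎)
  where
  open ≤-Reasoning
  q = r + suc (suc p)
  m = 4 + w
  j = 2 + i
  𝓣 = tower r (suc p)
  𝓢 = nearFull m j
  𝓐 = 𝓣 ⊞ 𝓢
  M = ⊥ {q} Vec.++ ⊤ {m}

  M∈𝓐 : M ∈ᶠ 𝓐
  M∈𝓐 = ⊞⁺ʳ (⊤∈nearFull m j)

  M-nonempty : Nonempty M
  M-nonempty = q ↑ʳ zero , lookup⇒[]= (q ↑ʳ zero) M (lookup-++ʳ (⊥ {q}) ⊤ zero)

  uc : UnionClosed 𝓐
  uc = record
    { distinct = unique-⊞ (unique-tower r (suc p)) (unique-nearFull m j) (tower-nonempty r (suc p))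
    ; nonempty = M , M∈𝓐 , M-nonempty
    ; closed   = ∪-⊞ (∪-tower r (suc p)) (∪-nearFull j) }

  2m<n : d ≡ 1 ⊎ d ≡ 2 → 2 * m ℕ.< q + m
  2m<n d≡ = subst₂ ℕ._<_ (cong (λ s → m + s) (sym (+-identityʳ m))) (cong (_+ m) (sym q≡)) (+-monoˡ-< m (m<n+m m (0<d d≡)))
    where
    0<d : d ≡ 1 ⊎ d ≡ 2 → 0 ℕ.< d
    0<d (inj₁ refl) = s≤s z≤n
    0<d (inj₂ refl) = s≤s z≤n

  n≤2[m+1] : d ≡ 1 ⊎ d ≡ 2 → q + m ≤ 2 * (m + 1)
  n≤2[m+1] d≡ = begin
    q + m         ≡⟨ cong (_+ m) q≡ ⟩
    d + m + m     ≤⟨ +-monoˡ-≤ m (+-monoˡ-≤ m (d≤2 d≡)) ⟩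
    2 + m + m     ≡⟨ double m ⟩
    2 * (m + 1)   ∎
    where
    double : ∀ m → 2 + m + m ≡ 2 * (m + 1)
    double = solve-∀

  below⊆M : ∀ {A} → View {𝓣 = 𝓣} {𝓢} A → 2 * ∣ A ∣ ℕ.< q + m → A ⊆ M
  below⊆M (small {S} _)  _  = ++-mono-⊆ {T = ⊥ {q}} {⊥} {S} (λ x → x) ⊆⊤
  -- A large member has at least m + 1 points, and n ≤ 2(m + 1).
  below⊆M (large {T} T∈) lt = contradiction lt (≤⇒≯ (≤-trans (n≤2[m+1] d≡) (*-monoʳ-≤ 2
    (subst (m + 1 ≤_) (sym (∣T++⊤∣≡m+∣T∣ m T)) (+-monoʳ-≤ m (tower-nonempty r (suc p) T∈))))))

  enough : (q + m) * (q + length 𝓢) ℕ.< 2 * (missing 𝓣 + (q * length 𝓢 + missing 𝓢))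
  enough = subst (λ q → (q + m) * (q + length 𝓢) ℕ.< 2 * (missing 𝓣 + (q * length 𝓢 + missing 𝓢))) (sym q≡)
    (missing-bound w d≡ (subst (_≤ suc (missing 𝓣)) q≡ (size≤missing-tower r (suc p)))
      (m*m+m+2≤2*length-nearFull m i) (m*m≤missing-nearFull m i))

-- The offset `d` is 1 for odd and 2 for even `suc n`, so `m` is the largest integer strictly below
-- its half.
halve : ∀ n → ∃[ m ] ∃[ d ] ((d ≡ 1 ⊎ d ≡ 2) × d + m + m ≡ suc n)
halve zero = 0 , 1 , inj₁ refl , refl
halve (suc n) with halve n
... | m , _ , inj₁ refl , eq = m , 2 , inj₂ refl , cong suc eq
... | m , _ , inj₂ refl , eq = suc m , 1 , inj₁ refl , cong suc (trans (cong suc (+-suc m m)) eq)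

4≤half : ∀ {d m} → d ≡ 1 ⊎ d ≡ 2 → 11 ≤ d + m + m → 4 ≤ m
4≤half {d} {m} d≡ 11≤n with 4 ≤? m
... | yes 4≤m = 4≤m
-- For `m ≤ 3` the total is at most 8, and `m≤m+n 9 2` reads 8 < 11.
... | no 4≰m  = contradiction (≤-trans 11≤n (+-mono-≤ (+-mono-≤ (d≤2 d≡) m≤3) m≤3)) (<⇒≱ (m≤m+n 9 2))
  where
  m≤3 : m ≤ 3
  m≤3 = ℕ.s≤s⁻¹ (≰⇒> 4≰m)

-- Heights up to m + 3 come from `r = 0` and `j` between 2 and m. Beyond that j = m, so all subsets
-- of M occur, and `r` supplies the rest; r = q - 2 gives height n + 1.
example : ∀ d w t → d ≡ 1 ⊎ d ≡ 2 → 5 + t ≤ d + (4 + w) + (4 + w) + 1 → Example (d + (4 + w) + (4 + w)) (5 + t)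
example d w t d≡ k≤n+1 with t ≤? 2 + w
... | yes t≤ = subst (λ q → Example (q + (4 + w)) (5 + t)) (size d w)
      (construction w 0 (d + 2 + w) t d≡ (size d w) (s≤s (s≤s t≤)))
  where
  size : ∀ d w → suc (suc (d + 2 + w)) ≡ d + (4 + w)
  size = solve-∀
... | no t≰ with m≤n⇒∃[o]m+o≡n (≰⇒> t≰)
-- The room left by k ≤ n + 1 is `d + 1 + w`, that is q - 3; what `s` leaves of it becomes `p`.
...   | s , refl with m≤n⇒∃[o]m+o≡n {s} {d + 1 + w} (+-cancelˡ-≤ (8 + w) s _ (subst (8 + w + s ≤_) (total d w) k≤n+1))
  where
  total : ∀ d w → d + (4 + w) + (4 + w) + 1 ≡ 8 + w + (d + 1 + w)
  total = solve-∀
...     | p , eq = subst₂ (λ q k → Example (q + (4 + w)) k) q≡ (height s w)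
            (construction w (suc s) p (2 + w) d≡ q≡ ≤-refl)
  where
  height : ∀ s w → 2 + suc s + suc (2 + (2 + w)) ≡ 5 + (3 + w + s)
  height = solve-∀
  move : ∀ s p → suc s + suc (suc p) ≡ 3 + (s + p)
  move = solve-∀
  size : ∀ d w → 3 + (d + 1 + w) ≡ d + (4 + w)
  size = solve-∀
  q≡ : suc s + suc (suc p) ≡ d + (4 + w)
  q≡ = trans (move s p) (trans (cong (λ x → 3 + x) eq) (size d w))

theorem3p2 : ∀ (n k : ℕ) → 11 ≤ n → 5 ≤ k → k ≤ n + 1 →
    Σ[ 𝓐 ∈ Family n ] Σ[ uc ∈ UnionClosed 𝓐 ]
    (b 𝓐 ≡ ⊤ × Separating 𝓐 × HasHeight 𝓐 k × (∣𝓑 𝓐 ∣≡ 1) × Avg 𝓐 uc < half n)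
theorem3p2 (suc n) k 11≤n 5≤k k≤n+1 with halve n | m≤n⇒∃[o]m+o≡n 5≤k
... | m , d , d≡ , eq | t , refl with m≤n⇒∃[o]m+o≡n (4≤half d≡ (subst (11 ≤_) (sym eq) 11≤n))
...   | w , refl = subst (λ n → Example n k) eq (example d w t d≡ (subst (λ n → k ≤ n + 1) (sym eq) k≤n+1))
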